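{- Let $n$ be a positive integer and let $a_0,a_1,\ldots,a_{n-1}$ be a permutation of $\mathbb{Z}_n=\{0,1,\ldots,n-1\}$. For each $i\in\mathbb{Z}_n$ let $k_i,j_i$ be positive integers and define $$N_i=\{i,i+1,\ldots,i+k_i-1\},\qquad A_i=\{a_i,a_{i+1},\ldots,a_{i+j_i-1}\},$$ where the elements of $N_i$ and the indices in $A_i$ are taken modulo $n$. Suppose that $|N_i|\ge 3$ and $|A_i|\ge 3$ for every $i\in\mathbb{Z}_n\setminus\{0\}$, and that $|N_0|\ge 2$ and $|A_0|\ge 2$. Then there exists a partition $\{B,R\}$ of $\mathbb{Z}_n$ such that for every $i\in\mathbb{Z}_n$ we have $N_i\not\subseteq B$ and $A_i\not\subseteq R$.
   Context: $\mathbb{Z}_n$ denotes the set of integers $\{0,1,\ldots,n-1\}$ with addition and multiplication taken modulo $n$. -}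

module Defs where

open import Data.Fin using (Fin; toℕ)
open import Data.Fin.Permutation using (Permutation′; _⟨$⟩ʳ_)
open import Data.Fin.Subset using (Subset; ⁅_⁆; ⊥; ⊤; ⋃; _∪_; _∩_; Nonempty)
open import Data.List using (List; map; upTo)
open import Data.Nat using (ℕ; NonZero; _+_)
open import Data.Nat.DivMod using (_mod_)
open import Relation.Binary.PropositionalEquality using (_≡_)

fromList : ∀ {n} → List (Fin n) → Subset n
fromList xs = ⋃ (map ⁅_⁆ xs)

module _ {n : ℕ} .{{_ : NonZero n}} where

  infixl 6 _⊕_

  _⊕_ : Fin n → ℕ → Fin n
  i ⊕ t = (toℕ i + t) mod n

  -- The lengths k i and j i may exceed n; N k i and A a j i are sets, so in
  -- that case they have n elements rather than k i and j i.

  N : (Fin n → ℕ) → Fin n → Subset n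
  N k i = fromList (map (λ t → i ⊕ t) (upTo (k i)))

  A : Permutation′ n → (Fin n → ℕ) → Fin n → Subset n
  A a j i = fromList (map (λ t → a ⟨$⟩ʳ (i ⊕ t)) (upTo (j i)))

record IsPartition {n : ℕ} (B R : Subset n) : Set where
  field
    nonemptyˡ : Nonempty B
    nonemptyʳ : Nonempty R
    disjoint  : B ∩ R ≡ ⊥
    covering  : B ∪ R ≡ ⊤

{-# OPTIONS --safe #-}

-- If n is even, the two perfect matchings {2i, 2i+1} and {a_{2i}, a_{2i+1}}
-- form a bipartite graph; a proper red/blue colouring of it works, because any
-- three cyclically consecutive positions contain a whole matched pair.
-- If n = 2m+1, then m+1 positions are even but only m values are odd, so some
-- even position r carries an even value p = a_r.  Delete p from the first cycle
-- and r from the second, match what remains in consecutive pairs starting from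
-- 0, and colour as before.  Colour p red; exchanging the two colours off p if
-- necessary, a_{r+1} is blue.  This repairs the arcs that contain no pair.

module Submission where

open import Defs
open import Data.Bool using (Bool; true; false; not; _xor_)
open import Data.Bool.Properties using (not-involutive; not-distribʳ-xor; xor-same)
open import Data.Empty using (⊥-elim)
open import Data.Fin using (Fin; zero; suc; toℕ; fromℕ<; punchIn; punchOut; _≟_)
open import Data.Fin.Permutation using (Permutation′; _⟨$⟩ʳ_; _⟨$⟩ˡ_; inverseˡ; inverseʳ; remove; punchIn-permute)
open import Data.Fin.Properties
  using (toℕ-injective; toℕ-fromℕ<; toℕ<n; suc-injective; pigeonhole; punchIn-punchOut; sequence)
open import Data.Fin.Subset using (Subset; ∣_∣; _∈_; _∉_; _⊈_; ⁅_⁆; _∪_; ∁)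
open import Data.Fin.Subset.Properties
  using (∣p∣≤n; ∣⊥∣≡0; x∈⁅x⁆; p⊆p∪q; q⊆p∪q; x∈p⇒x∉∁p;
    x∉p⇒x∈∁p; p∪∁p≡⊤; ∪-comm; ∪-identityˡ; ∩-inverseˡ)
open import Data.List using (List; []; _∷_; map; upTo; length)
open import Data.List.Membership.Propositional using () renaming (_∈_ to _∈ˡ_)
open import Data.List.Membership.Propositional.Properties using (∈-map⁺; ∈-upTo⁺)
open import Data.List.Properties using (length-map; length-upTo)
open import Data.List.Relation.Unary.Any using (here; there)
open import Data.Nat using (ℕ; zero; suc; NonZero; _+_; _*_; _≤_; _<_; z≤n; s≤s)
open import Data.Nat.DivMod using (_mod_; _%_; m%n<n; m<n⇒m%n≡m; n%n≡0; [m+n]%n≡m%n)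
open import Data.Nat.Properties
  using (≤-trans; ≤-reflexive; ≤-refl; <⇒≤; <-trans; +-comm; 1+n≢n; ≮⇒≥; m≤n⇒m<n∨m≡n;
    *-monoˡ-≤; *-monoˡ-<; *-cancelʳ-<; *-cancelʳ-≡; *-cancelʳ-≤; n≤1+n; <-irrefl;
    n<1+n; ≤-pred; _<?_)
  renaming (suc-injective to ℕ-suc-injective)
open import Data.Product using (_×_; _,_; proj₁; proj₂; ∃; ∃₂; ∃-syntax)
import Data.Sum as Sum
open import Data.Sum using (_⊎_; inj₁; inj₂)
import Data.Sum.Effectful.Left as Sumₗ
open import Data.Vec using (tabulate; _∷_)
open import Data.Vec.Functional using (insertAt)
open import Data.Vec.Functional.Properties using (insertAt-lookup; insertAt-punchIn)
open import Data.Vec.Properties using (lookup∘tabulate; lookup⇒[]=; []=⇒lookup)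
open import Function using (_∘_; id)
open import Level using (0ℓ)
open import Relation.Nullary using (¬_; yes; no; contradiction)
open import Relation.Binary.PropositionalEquality
  using (_≡_; _≢_; refl; sym; trans; cong; subst)

-- Pairing consecutive elements, and alternating colourings

twin : ∀ {n} → Fin n → Fin n
twin {1}           zero          = zero
twin {suc (suc n)} zero          = suc zero
twin {suc (suc n)} (suc zero)    = zero
twin {suc (suc n)} (suc (suc x)) = suc (suc (twin x))

twin-involutive : ∀ {n} (x : Fin n) → twin (twin x) ≡ x
twin-involutive {1}           zero          = refl
twin-involutive {suc (suc n)} zero          = refl
twin-involutive {suc (suc n)} (suc zero)    = refl
twin-involutive {suc (suc n)} (suc (suc x)) = cong (λ y → suc (suc y)) (twin-involutive x)

twin-irrefl : ∀ m (x : Fin (m * 2)) → twin x ≢ x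
twin-irrefl (suc m) (suc (suc x)) eq = twin-irrefl m x (suc-injective (suc-injective eq))

toℕ-twin : ∀ {m} i (x : Fin (m * 2)) → toℕ x ≡ i * 2 → toℕ (twin x) ≡ suc (i * 2)
toℕ-twin {suc m} zero    zero          eq = refl
toℕ-twin {suc m} (suc i) (suc (suc x)) eq =
  cong (λ t → suc (suc t)) (toℕ-twin {m} i x (ℕ-suc-injective (ℕ-suc-injective eq)))
toℕ-twin {suc m} (suc zero)    (suc zero) ()
toℕ-twin {suc m} (suc (suc i)) (suc zero) ()

-- A perfect matching is encoded as a fixed-point-free involution `g`; for such a `g` this is
-- properness of a 2-colouring on its edges.
Alternates : ∀ {A : Set} → (A → A) → (A → Bool) → Set
Alternates g c = ∀ x → c (g x) ≡ not (c x)

alternates-cong : ∀ {A : Set} {g : A → A} {c d : A → Bool} → (∀ x → c x ≡ d x) →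
                  Alternates g d → Alternates g c
alternates-cong c≗d d-alt x = trans (c≗d _) (trans (d-alt x) (cong not (sym (c≗d x))))

xor-alternates : ∀ {A : Set} {g : A → A} {c : A → Bool} s → Alternates g c →
                 Alternates g (λ x → s xor c x)
xor-alternates s c-alt x = trans (cong (s xor_) (c-alt x)) (sym (not-distribʳ-xor s _))

-- Two-colouring the union of two perfect matchings

module Contraction {k} (g : Fin (2 + k) → Fin (2 + k))
  (g-inv : ∀ x → g (g x) ≡ x) (g-irr : ∀ x → g x ≢ x) where

  g-flip : ∀ {x y} → g x ≡ y → g y ≡ x
  g-flip {x} refl = g-inv x

  g-inj : ∀ {x y z} → g x ≡ z → g y ≡ z → x ≡ y
  g-inj p q = trans (sym (g-flip p)) (g-flip q)

  -- The matching left after the edge {0,1} is contracted: besides the surviving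
  -- edges of g, the partners of 0 and 1 become matched.
  data Link (x y : Fin k) : Set where
    direct : g (suc (suc x)) ≡ suc (suc y) → Link x y
    via₀₁  : g zero ≡ suc (suc x) → g (suc zero) ≡ suc (suc y) → Link x y
    via₁₀  : g (suc zero) ≡ suc (suc x) → g zero ≡ suc (suc y) → Link x y

  link-sym : ∀ {x y} → Link x y → Link y x
  link-sym (direct p)  = direct (g-flip p)
  link-sym (via₀₁ p q) = via₁₀ q p
  link-sym (via₁₀ p q) = via₀₁ q p

  link-irrefl : ∀ {x} → ¬ Link x x
  link-irrefl (direct p)  = g-irr _ p
  link-irrefl (via₀₁ p q) with () ← g-inj p q
  link-irrefl (via₁₀ p q) with () ← g-inj p q

  -- Since 0 and 1 have one `g`-partner each, no vertex is linked in two ways. With `link-sym` this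
  -- makes `contracted` an involution.
  link-det : ∀ {x y z} → Link x y → Link x z → y ≡ z
  link-det (direct p)  (direct q)    = suc-injective (suc-injective (trans (sym p) q))
  link-det (direct p)  (via₀₁ q _) with () ← trans (sym (g-flip q)) p
  link-det (direct p)  (via₁₀ q _) with () ← trans (sym (g-flip q)) p
  link-det (via₀₁ p _) (direct q)  with () ← trans (sym (g-flip p)) q
  link-det (via₁₀ p _) (direct q)  with () ← trans (sym (g-flip p)) q
  link-det (via₀₁ _ p) (via₀₁ _ q)   = suc-injective (suc-injective (trans (sym p) q))
  link-det (via₁₀ _ p) (via₁₀ _ q)   = suc-injective (suc-injective (trans (sym p) q))
  link-det (via₀₁ p _) (via₁₀ q _) with () ← g-inj p q
  link-det (via₁₀ p _) (via₀₁ q _) with () ← g-inj p q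

  link-total : ∀ x → ∃ (Link x)
  link-total x with g (suc (suc x)) in eq
  ... | suc (suc y) = y , direct eq
  ... | zero with g (suc zero) in eq₁
  ...   | suc (suc y) = y , via₀₁ (g-flip eq) eq₁
  ...   | suc zero    = contradiction eq₁ (g-irr _)
  ...   | zero with () ← g-inj eq eq₁
  link-total x | suc zero with g zero in eq₀
  ...   | suc (suc y) = y , via₁₀ (g-flip eq) eq₀
  ...   | zero        = contradiction eq₀ (g-irr _)
  ...   | suc zero with () ← g-inj eq eq₀

  contracted : Fin k → Fin k
  contracted x = proj₁ (link-total x)

  contracted-inv : ∀ x → contracted (contracted x) ≡ x
  contracted-inv x =
    link-det (proj₂ (link-total (contracted x))) (link-sym (proj₂ (link-total x)))

  contracted-irr : ∀ x → contracted x ≢ x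
  contracted-irr x eq = link-irrefl (subst (Link x) eq (proj₂ (link-total x)))

  module _ (c : Fin k → Bool) (c-alt : Alternates contracted c) where

    link-alt : ∀ {x y} → Link x y → c y ≡ not (c x)
    link-alt {x} l = trans (cong c (link-det l (proj₂ (link-total x)))) (c-alt x)

    -- Applied to the partner of 0, this is the colour forced on 0. The value at `suc zero` settles
    -- the free choice when 0 and 1 are partners; at `zero` it is a default.
    opposite-colour : Fin (2 + k) → Bool
    opposite-colour zero          = false
    opposite-colour (suc zero)    = false
    opposite-colour (suc (suc a)) = not (c a)

    extended : Fin (2 + k) → Bool
    extended zero          = opposite-colour (g zero)
    extended (suc zero)    = not (opposite-colour (g zero))
    extended (suc (suc x)) = c x

    -- The delicate edge is the one at 1, which was coloured against 0 rather than against its own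
    -- partner. The partners of 0 and 1 are linked, hence oppositely coloured, just as 0 and 1 are.
    extended-alt : Alternates g extended
    extended-alt zero with g zero in eq
    ... | zero        = contradiction eq (g-irr _)
    ... | suc zero    = cong (not ∘ opposite-colour) eq
    ... | suc (suc a) = sym (not-involutive (c a))
    extended-alt (suc zero) with g (suc zero) in eq
    ... | suc zero    = contradiction eq (g-irr _)
    ... | zero        = sym (not-involutive _)
    ... | suc (suc b) with g zero in eq₀
    ...   | zero        = contradiction eq₀ (g-irr _)
    ...   | suc zero with () ← trans (sym eq) (g-flip eq₀)
    ...   | suc (suc a) = trans (link-alt (via₀₁ eq₀ eq)) (sym (not-involutive _))
    extended-alt (suc (suc x)) with g (suc (suc x)) in eq
    ... | suc (suc y) = link-alt (direct eq)
    ... | zero        = cong opposite-colour (g-flip eq)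
    ... | suc zero with g zero in eq₀
    ...   | zero        = contradiction eq₀ (g-irr _)
    ...   | suc zero with () ← g-inj eq eq₀
    ...   | suc (suc a) = cong not (sym (link-alt (via₀₁ eq₀ (g-flip eq))))

-- Induction on the edges of `twin`: contracting {0, 1} leaves a perfect matching on the other
-- vertices, where `twin` is again `twin`, shifted by two.
two-colour : ∀ m (g : Fin (m * 2) → Fin (m * 2)) → (∀ x → g (g x) ≡ x) → (∀ x → g x ≢ x) →
             ∃[ c ] Alternates twin c × Alternates g c
two-colour zero    g g-inv g-irr = (λ ()) , (λ ()) , (λ ())
two-colour (suc m) g g-inv g-irr = extended c c-alt , twin-alt , extended-alt c c-alt
  where
  open Contraction g g-inv g-irr
  rec = two-colour m contracted contracted-inv contracted-irr
  c = proj₁ rec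
  c-alt = proj₂ (proj₂ rec)
  twin-alt : Alternates twin (extended c c-alt)
  twin-alt zero          = refl
  twin-alt (suc zero)    = sym (not-involutive _)
  twin-alt (suc (suc x)) = proj₁ (proj₂ rec) x

-- Conjugating `twin` by `b` matches the values that sit at paired positions; alternating along this
-- matching is alternating along positions after composing with `b`.
two-colour-perm : ∀ m (b : Permutation′ (m * 2)) →
                  ∃[ c ] Alternates twin c × Alternates twin (c ∘ (b ⟨$⟩ʳ_))
two-colour-perm m b = c , c-twin , λ z →
  trans (cong (c ∘ (b ⟨$⟩ʳ_) ∘ twin) (sym (inverseˡ b))) (c-g (b ⟨$⟩ʳ z))
  where
  g : Fin (m * 2) → Fin (m * 2)
  g y = b ⟨$⟩ʳ twin (b ⟨$⟩ˡ y)
  g-inv : ∀ y → g (g y) ≡ y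
  g-inv y = trans (cong (λ z → b ⟨$⟩ʳ twin z) (inverseˡ b))
    (trans (cong (b ⟨$⟩ʳ_) (twin-involutive _)) (inverseʳ b))
  g-irr : ∀ y → g y ≢ y
  g-irr y eq = twin-irrefl m (b ⟨$⟩ˡ y) (trans (sym (inverseˡ b)) (cong (b ⟨$⟩ˡ_) eq))
  result = two-colour m g g-inv g-irr
  c = proj₁ result
  c-twin = proj₁ (proj₂ result)
  c-g = proj₂ (proj₂ result)

-- Windows of two positions inside arcs of two or three

parity : ∀ t → (∃[ i ] t ≡ i * 2) ⊎ (∃[ i ] t ≡ suc (i * 2))
parity zero = inj₁ (0 , refl)
parity (suc t) with parity t
... | inj₁ (i , refl) = inj₂ (i , refl)
... | inj₂ (i , refl) = inj₁ (suc i , refl)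

-- This concerns the window {t, t+1}. Three consecutive positions contain two such windows, hence
-- the disjunction in `Meets`; the arc at 0 may have only one.
Covered : (ℕ → Bool) → ℕ → Set
Covered D t = D t ≡ true ⊎ D (suc t) ≡ true

-- D t stands for the colour at position t modulo n.
Meets : ℕ → (ℕ → Bool) → Set
Meets n D = Covered D 0 × (∀ t → t < n → Covered D t ⊎ Covered D (suc t))

meets-even : ∀ m {D} → 0 < m → D (m * 2) ≡ D 0 → D (suc (m * 2)) ≡ D 1 →
             (∀ i → i < m → Covered D (i * 2)) → Meets (m * 2) D
meets-even m {D} 0<m per₀ per₁ pairs = pairs 0 0<m , meets
  where
  meets : ∀ t → t < m * 2 → Covered D t ⊎ Covered D (suc t)
  meets t t<n with parity t
  ... | inj₁ (i , refl) = inj₁ (pairs i (*-cancelʳ-< 2 i m t<n))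
  ... | inj₂ (i , refl) with m≤n⇒m<n∨m≡n (*-cancelʳ-< 2 i m (<-trans (n<1+n _) t<n))
  ...   | inj₁ si<m = inj₂ (pairs (suc i) si<m)
  -- The arc starts at the last position, so its second window wraps round to {0, 1}.
  ...   | inj₂ refl = inj₂ (Sum.map (trans per₀) (trans per₁) (pairs 0 0<m))

-- Deleting position 2q shifts the later pairs: windows starting at even positions up to 2q, and at
-- odd positions beyond it, are covered. Every `t` or its successor is such a start, up to wrapping.
meets-odd : ∀ m q {D} → q ≤ m → D (suc (m * 2)) ≡ D 0 → D (2 + m * 2) ≡ D 1 →
            (∀ i → i < q → Covered D (i * 2)) → Covered D (q * 2) →
            (∀ i → q ≤ i → i < m → Covered D (suc (i * 2))) → Meets (suc (m * 2)) D
meets-odd m q {D} q≤m per₀ per₁ below at above = start , meets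
  where
  up-to : ∀ i → i ≤ q → Covered D (i * 2)
  up-to i i≤q with m≤n⇒m<n∨m≡n i≤q
  ... | inj₁ i<q  = below i i<q
  ... | inj₂ refl = at
  start : Covered D 0
  start = up-to 0 z≤n
  meets : ∀ t → t < suc (m * 2) → Covered D t ⊎ Covered D (suc t)
  meets t t<n with parity t
  -- The bound is `suc q` because the window at 2q itself counts as covered.
  ... | inj₁ (i , refl) with i <? suc q
  ...   | yes (s≤s i≤q) = inj₁ (up-to i i≤q)
  ...   | no  i≰q with m≤n⇒m<n∨m≡n (*-cancelʳ-≤ i m 2 (≤-pred t<n))
  ...     | inj₁ i<m  = inj₂ (above i (<⇒≤ (≮⇒≥ i≰q)) i<m)
  ...     | inj₂ refl = inj₂ (Sum.map (trans per₀) (trans per₁) start)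
  meets t t<n | inj₂ (i , refl) with i <? q
  ...   | yes i<q = inj₂ (up-to (suc i) i<q)
  ...   | no  i≮q = inj₁ (above i (≮⇒≥ i≮q) (*-cancelʳ-< 2 i m (≤-pred t<n)))

-- From alternating colourings to covered windows

module _ {n : ℕ} .{{_ : NonZero n}} where

  toℕ-mod : ∀ t → toℕ (t mod n) ≡ t % n
  toℕ-mod t = toℕ-fromℕ< (m%n<n t n)

  mod-toℕ : ∀ {t} (x : Fin n) → toℕ x ≡ t → t mod n ≡ x
  mod-toℕ x refl = toℕ-injective (trans (toℕ-mod _) (m<n⇒m%n≡m (toℕ<n x)))

  mod-periodic : ∀ t → (t + n) mod n ≡ t mod n
  mod-periodic t = toℕ-injective (trans (toℕ-mod _) (trans ([m+n]%n≡m%n t n) (sym (toℕ-mod t))))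

cover : ∀ {n} .{{_ : NonZero n}} (d : Fin n → Bool) {t} (x y : Fin n) →
        toℕ x ≡ t → toℕ y ≡ suc t → d y ≡ not (d x) → Covered (λ s → d (s mod n)) t
cover d x y x≡t y≡1+t opp rewrite mod-toℕ x x≡t | mod-toℕ y y≡1+t with d x
... | true  = inj₁ refl
... | false = inj₂ opp

toℕ-punchIn-< : ∀ {n} (p : Fin (suc n)) x → toℕ x < toℕ p → toℕ (punchIn p x) ≡ toℕ x
toℕ-punchIn-< (suc p) zero    _         = refl
toℕ-punchIn-< (suc p) (suc x) (s≤s x<p) = cong suc (toℕ-punchIn-< p x x<p)

toℕ-punchIn-≥ : ∀ {n} (p : Fin (suc n)) x → toℕ p ≤ toℕ x → toℕ (punchIn p x) ≡ suc (toℕ x)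
toℕ-punchIn-≥ zero    x       _         = refl
toℕ-punchIn-≥ (suc p) (suc x) (s≤s p≤x) = cong suc (toℕ-punchIn-≥ p x p≤x)

record PairAt (m i : ℕ) : Set where
  field
    left      : Fin (m * 2)
    toℕ-left  : toℕ left ≡ i * 2
    toℕ-right : toℕ (twin left) ≡ suc (i * 2)

pairAt : ∀ {m i} → i < m → PairAt m i
pairAt {m} {i} i<m = record
  { left      = fromℕ< 2i<2m
  ; toℕ-left  = toℕ-fromℕ< 2i<2m
  ; toℕ-right = toℕ-twin {m} i _ (toℕ-fromℕ< 2i<2m)
  }
  where 2i<2m = *-monoˡ-< 2 i<m

alternates⇒meets-even : ∀ m .{{_ : NonZero (m * 2)}} (d : Fin (m * 2) → Bool) → 0 < m →
  Alternates twin d → Meets (m * 2) (λ t → d (t mod (m * 2)))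
alternates⇒meets-even m d 0<m d-alt =
  meets-even m 0<m (cong d (mod-periodic 0)) (cong d (mod-periodic 1)) pairs
  where
  pairs : ∀ i → i < m → Covered (λ t → d (t mod (m * 2))) (i * 2)
  pairs i i<m = cover d left (twin left) toℕ-left toℕ-right (d-alt left)
    where open PairAt (pairAt i<m)

-- As `p` is even, reinserting it by `punchIn p` separates no pair: pairs below `p` keep their
-- positions and those above move up by one.
alternates⇒meets-odd : ∀ m q (d : Fin (suc (m * 2)) → Bool) (p : Fin (suc (m * 2))) →
  toℕ p ≡ q * 2 → q ≤ m → Alternates twin (d ∘ punchIn p) →
  d p ≡ true ⊎ d (p ⊕ 1) ≡ true → Meets (suc (m * 2)) (λ t → d (t mod suc (m * 2)))
alternates⇒meets-odd m q d p p≡2q q≤m d-alt at =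
  meets-odd m q q≤m (cong d (mod-periodic 0)) (cong d (mod-periodic 1)) below covered-p above
  where
  n = suc (m * 2)
  D : ℕ → Bool
  D t = d (t mod n)
  covered-p : Covered D (q * 2)
  covered-p = Sum.map (trans (cong d (mod-toℕ p p≡2q)))
    (trans (cong (λ t → d (t mod n)) (trans (cong suc (sym p≡2q)) (+-comm 1 (toℕ p))))) at
  below : ∀ i → i < q → Covered D (i * 2)
  below i i<q = cover d (punchIn p left) (punchIn p (twin left))
    (trans (toℕ-punchIn-< p _ (left<p toℕ-left (n≤1+n _))) toℕ-left)
    (trans (toℕ-punchIn-< p _ (left<p toℕ-right ≤-refl)) toℕ-right)
    (d-alt left)
    where
    open PairAt (pairAt (≤-trans i<q q≤m))
    left<p : ∀ {x t} → x ≡ t → t ≤ suc (i * 2) → x < toℕ p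
    left<p refl t≤ rewrite p≡2q = ≤-trans (s≤s t≤) (*-monoˡ-≤ 2 i<q)
  above : ∀ i → q ≤ i → i < m → Covered D (suc (i * 2))
  above i q≤i i<m = cover d (punchIn p left) (punchIn p (twin left))
    (trans (toℕ-punchIn-≥ p _ (p≤left toℕ-left ≤-refl)) (cong suc toℕ-left))
    (trans (toℕ-punchIn-≥ p _ (p≤left toℕ-right (n≤1+n _))) (cong suc toℕ-right))
    (d-alt left)
    where
    open PairAt (pairAt i<m)
    p≤left : ∀ {x t} → x ≡ t → i * 2 ≤ t → toℕ p ≤ x
    p≤left refl ≤t rewrite p≡2q = ≤-trans (*-monoˡ-≤ 2 q≤i) ≤t

-- An even position carrying an even value

-- Sequencing in the sum applicative either stops at a witness of `P` or collects `Q` at every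
-- index.
∃⊎∀ : ∀ {n} {P Q : Fin n → Set} → (∀ i → P i ⊎ Q i) → ∃ P ⊎ (∀ i → Q i)
∃⊎∀ {P = P} h = sequence (Sumₗ.applicative (∃ P) 0ℓ) (λ i → Sum.map₁ (i ,_) (h i))

double : ∀ {m} → Fin (suc m) → Fin (suc (m * 2))
double i = fromℕ< (s≤s (*-monoˡ-≤ 2 (≤-pred (toℕ<n i))))

toℕ-double : ∀ {m} (i : Fin (suc m)) → toℕ (double i) ≡ toℕ i * 2
toℕ-double i = toℕ-fromℕ< (s≤s (*-monoˡ-≤ 2 (≤-pred (toℕ<n i))))

-- If the values at all m+1 even positions were odd, halving them would land in m numbers; a
-- collision contradicts injectivity of `a`.
even-to-even : ∀ m (a : Permutation′ (suc (m * 2))) →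
  ∃[ r ] (∃[ i ] toℕ r ≡ i * 2) × (∃[ i ] toℕ (a ⟨$⟩ʳ r) ≡ i * 2)
even-to-even m a with ∃⊎∀ (λ i → parity (toℕ (a ⟨$⟩ʳ double i)))
... | inj₁ (i , even) = double i , (toℕ i , toℕ-double i) , even
... | inj₂ odd = ⊥-elim (collide (pigeonhole ≤-refl half))
  where
  half<m : ∀ i → proj₁ (odd i) < m
  half<m i = *-cancelʳ-< 2 _ m (≤-pred (subst (_< suc (m * 2)) (proj₂ (odd i)) (toℕ<n (a ⟨$⟩ʳ double i))))
  half : Fin (suc m) → Fin m
  half i = fromℕ< (half<m i)
  collide : ¬ (∃₂ λ i j → toℕ i < toℕ j × half i ≡ half j)
  collide (i , j , i<j , eq) = <-irrefl 2i≡2j i<j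
    where
    halves : proj₁ (odd i) ≡ proj₁ (odd j)
    halves = trans (sym (toℕ-fromℕ< (half<m i))) (trans (cong toℕ eq) (toℕ-fromℕ< (half<m j)))
    values : a ⟨$⟩ʳ double i ≡ a ⟨$⟩ʳ double j
    values = toℕ-injective (trans (proj₂ (odd i))
      (trans (cong (λ h → suc (h * 2)) halves) (sym (proj₂ (odd j)))))
    doubles : double i ≡ double j
    doubles = trans (sym (inverseˡ a)) (trans (cong (a ⟨$⟩ˡ_) values) (inverseˡ a))
    2i≡2j : toℕ i ≡ toℕ j
    2i≡2j = *-cancelʳ-≡ _ _ 2
      (trans (sym (toℕ-double i)) (trans (cong toℕ doubles) (toℕ-double j)))

-- Colourings that serve both cycles

-- true is red.
GoodColouring : ∀ n .{{_ : NonZero n}} → Permutation′ n → (Fin n → Bool) → Set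
GoodColouring n a c =
  Meets n (λ t → c (t mod n)) × Meets n (λ t → not (c (a ⟨$⟩ʳ (t mod n))))

colouring-even : ∀ m .{{_ : NonZero (m * 2)}} (a : Permutation′ (m * 2)) → 0 < m →
                 ∃ (GoodColouring (m * 2) a)
colouring-even m a 0<m with c , c-alt , ca-alt ← two-colour-perm m a =
  c , alternates⇒meets-even m c 0<m c-alt
    , alternates⇒meets-even m (λ x → not (c (a ⟨$⟩ʳ x))) 0<m (cong not ∘ ca-alt)

-- Without wrapping the successor is larger by one; with wrapping it is 0, and equality would force
-- n = 1.
⊕1-irrefl : ∀ {n} .{{_ : NonZero n}} → 2 ≤ n → (x : Fin n) → x ⊕ 1 ≢ x
⊕1-irrefl {n} 2≤n x eq with m≤n⇒m<n∨m≡n (toℕ<n x)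
... | inj₁ 1+x<n = 1+n≢n (trans (sym step) (cong toℕ eq))
  where
  step : toℕ (x ⊕ 1) ≡ suc (toℕ x)
  step = trans (toℕ-mod (toℕ x + 1))
    (trans (cong (_% n) (+-comm (toℕ x) 1)) (m<n⇒m%n≡m 1+x<n))
... | inj₂ 1+x≡n = <-irrefl (trans (cong suc (trans (sym wrap) (cong toℕ eq))) 1+x≡n) 2≤n
  where
  wrap : toℕ (x ⊕ 1) ≡ 0
  wrap = trans (toℕ-mod (toℕ x + 1)) (trans (cong (_% n) (trans (+-comm (toℕ x) 1) 1+x≡n)) (n%n≡0 n))

colouring-odd : ∀ m (a : Permutation′ (suc (m * 2))) → 0 < m →
                ∃ (GoodColouring (suc (m * 2)) a)
colouring-odd m a 0<m with r , (i , r≡2i) , (q , p≡2q) ← even-to-even m a =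
  c , alternates⇒meets-odd m q c p p≡2q (half≤ p≡2q) c-alt (inj₁ (insertAt-lookup c₁ p true))
    , alternates⇒meets-odd m i (λ x → not (c (a ⟨$⟩ʳ x))) r r≡2i (half≤ r≡2i) ca-alt (inj₂ next-blue)
  where
  n = suc (m * 2)
  p = a ⟨$⟩ʳ r
  -- Position `r` and value `p` are deleted together, so `b` permutes 2m elements and
  -- `two-colour-perm` handles both shortened cycles at once.
  b = remove r a
  half≤ : ∀ {x : Fin n} {h} → toℕ x ≡ h * 2 → h ≤ m
  half≤ {x} {h} eq = *-cancelʳ-≤ h m 2 (≤-pred (subst (_< n) eq (toℕ<n x)))
  result = two-colour-perm m b
  c₀ = proj₁ result
  r≢r⊕1 : r ≢ r ⊕ 1
  r≢r⊕1 eq = ⊕1-irrefl (<⇒≤ (s≤s (*-monoˡ-≤ 2 0<m))) r (sym eq)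
  z = punchOut r≢r⊕1
  -- `z` is the position `r ⊕ 1` in the shortened cycle; xor with its colour `s` makes that position
  -- `false`, that is blue.
  s = c₀ (b ⟨$⟩ʳ z)
  c₁ : Fin (m * 2) → Bool
  c₁ x = s xor c₀ x
  c : Fin n → Bool
  -- Red at `p` covers the window at `p` in the first cycle. In the second cycle `p` sits at `r`, so
  -- blue must come from `r ⊕ 1`.
  c = insertAt c₁ p true
  c-alt : Alternates twin (c ∘ punchIn p)
  c-alt = alternates-cong (insertAt-punchIn c₁ p true) (xor-alternates s (proj₁ (proj₂ result)))
  ca-punchIn : ∀ x → c (a ⟨$⟩ʳ punchIn r x) ≡ c₁ (b ⟨$⟩ʳ x)
  ca-punchIn x = trans (cong c (punchIn-permute a r x)) (insertAt-punchIn c₁ p true _)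
  ca-alt : Alternates twin (λ x → not (c (a ⟨$⟩ʳ punchIn r x)))
  ca-alt = cong not ∘ alternates-cong ca-punchIn (xor-alternates s (proj₂ (proj₂ result)))
  next-blue : not (c (a ⟨$⟩ʳ (r ⊕ 1))) ≡ true
  next-blue = cong not (trans (cong (λ x → c (a ⟨$⟩ʳ x)) (sym (punchIn-punchOut r≢r⊕1)))
    (trans (ca-punchIn z) (xor-same s)))

colouring : ∀ n .{{_ : NonZero n}} (a : Permutation′ n) → 2 ≤ n → ∃ (GoodColouring n a)
colouring n a 2≤n with parity n
colouring n a 2≤n        | inj₁ (suc m , refl) = colouring-even (suc m) a (s≤s z≤n)
colouring n a (s≤s ())   | inj₂ (zero , refl)
colouring n a 2≤n        | inj₂ (suc m , refl) = colouring-odd (suc m) a (s≤s z≤n)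

-- Arcs as finite sets

∣⁅x⁆∪p∣≤1+∣p∣ : ∀ {n} (x : Fin n) (p : Subset n) → ∣ ⁅ x ⁆ ∪ p ∣ ≤ suc ∣ p ∣
∣⁅x⁆∪p∣≤1+∣p∣ zero    (true  ∷ p) rewrite ∪-identityˡ p = n≤1+n _
∣⁅x⁆∪p∣≤1+∣p∣ zero    (false ∷ p) rewrite ∪-identityˡ p = ≤-refl
∣⁅x⁆∪p∣≤1+∣p∣ (suc x) (true  ∷ p) = s≤s (∣⁅x⁆∪p∣≤1+∣p∣ x p)
∣⁅x⁆∪p∣≤1+∣p∣ (suc x) (false ∷ p) = ∣⁅x⁆∪p∣≤1+∣p∣ x p

∣fromList∣≤length : ∀ {n} (xs : List (Fin n)) → ∣ fromList xs ∣ ≤ length xs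
∣fromList∣≤length {n} []   = ≤-reflexive (∣⊥∣≡0 n)
∣fromList∣≤length (x ∷ xs) = ≤-trans (∣⁅x⁆∪p∣≤1+∣p∣ x _) (s≤s (∣fromList∣≤length xs))

∈-fromList : ∀ {n} {x : Fin n} {xs} → x ∈ˡ xs → x ∈ fromList xs
∈-fromList {x = x} (here refl) = p⊆p∪q _ (x∈⁅x⁆ x)
∈-fromList (there x∈xs)        = q⊆p∪q _ _ (∈-fromList x∈xs)

module _ {n : ℕ} .{{_ : NonZero n}} (f : Fin n → Fin n) (l : Fin n → ℕ) where

  -- Both `N` (with `f = id`) and `A` (with `f` the permutation) are instances by unfolding.
  arc : Fin n → Subset n
  arc i = fromList (map (λ t → f (i ⊕ t)) (upTo (l i)))

  -- This turns lower bounds on the number of elements into lower bounds on the length, which may be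
  -- larger when the arc overlaps itself.
  ∣arc∣≤ : ∀ i → ∣ arc i ∣ ≤ l i
  ∣arc∣≤ i = ≤-trans (∣fromList∣≤length (map (λ t → f (i ⊕ t)) (upTo (l i))))
    (≤-reflexive (trans (length-map _ (upTo (l i))) (length-upTo (l i))))

  ∈-arc : ∀ i {t} → t < l i → f (i ⊕ t) ∈ arc i
  ∈-arc i t<l = ∈-fromList (∈-map⁺ (λ t → f (i ⊕ t)) (∈-upTo⁺ t<l))

  -- Here `s` is the offset of the window within the arc: offset 0 takes length 2, offset 1 takes
  -- length 3.
  covered⇒hit : ∀ {c : Fin n → Bool} i s → 2 + s ≤ l i →
    Covered (λ t → c (f (t mod n))) (s + toℕ i) → ∃[ x ] x ∈ arc i × c x ≡ true
  covered⇒hit {c} i s 2+s≤l (inj₁ red) = _ , ∈-arc i (<⇒≤ 2+s≤l) ,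
    subst (λ t → c (f (t mod n)) ≡ true) (+-comm s (toℕ i)) red
  covered⇒hit {c} i s 2+s≤l (inj₂ red) = _ , ∈-arc i 2+s≤l ,
    subst (λ t → c (f (t mod n)) ≡ true) (+-comm (suc s) (toℕ i)) red

  meets⇒hits : ∀ {c : Fin n → Bool} → Meets n (λ t → c (f (t mod n))) →
    (∀ i → i ≢ 0 mod n → 3 ≤ ∣ arc i ∣) → 2 ≤ ∣ arc (0 mod n) ∣ →
    ∀ i → ∃[ x ] x ∈ arc i × c x ≡ true
  meets⇒hits {c} (start , meets) len≥3 len≥2 i with i ≟ 0 mod n
  ... | yes refl = covered⇒hit (0 mod n) 0 (≤-trans len≥2 (∣arc∣≤ _))
    (subst (Covered (λ t → c (f (t mod n)))) (sym toℕ-0mod) start)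
    where
    toℕ-0mod : toℕ (0 mod n) ≡ 0
    toℕ-0mod = trans (toℕ-mod 0) (m<n⇒m%n≡m (≤-trans (s≤s z≤n) (toℕ<n (0 mod n))))
  ... | no i≢0 with l≥3 ← ≤-trans (len≥3 i i≢0) (∣arc∣≤ i) | meets (toℕ i) (toℕ<n i)
  ...   | inj₁ covered = covered⇒hit i 0 (<⇒≤ l≥3) covered
  ...   | inj₂ covered = covered⇒hit i 1 l≥3 covered

-- The partition into colour classes

theorem2p1 : (n : ℕ) .{{_ : NonZero n}} (a : Permutation′ n) (k j : Fin n → ℕ)
    → (∀ i → 0 < k i) → (∀ i → 0 < j i)
    → (∀ i → i ≢ 0 mod n → 3 ≤ ∣ N k i ∣ × 3 ≤ ∣ A a j i ∣)
    → 2 ≤ ∣ N k (0 mod n) ∣ → 2 ≤ ∣ A a j (0 mod n) ∣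
    → ∃₂ λ (B R : Subset n) → IsPartition B R × (∀ i → N k i ⊈ B × A a j i ⊈ R)
theorem2p1 n a k j _ _ len≥3 lenN≥2 lenA≥2
  -- The two elements of the arc at 0 give n ≥ 2.
  with c , meetsN , meetsA ← colouring n a (≤-trans lenN≥2 (∣p∣≤n (N k (0 mod n)))) =
  ∁ R , R , partition , λ i → N⊈B i , A⊈R i
  where
  R : Subset n
  R = tabulate c
  hitsN : ∀ i → ∃[ x ] x ∈ N k i × c x ≡ true
  hitsN = meets⇒hits id k {c} meetsN (λ i i≢0 → proj₁ (len≥3 i i≢0)) lenN≥2
  hitsA : ∀ i → ∃[ x ] x ∈ A a j i × not (c x) ≡ true
  hitsA = meets⇒hits (a ⟨$⟩ʳ_) j {not ∘ c} meetsA (λ i i≢0 → proj₂ (len≥3 i i≢0)) lenA≥2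
  red : ∀ {x} → c x ≡ true → x ∈ R
  red {x} cx = lookup⇒[]= x R (trans (lookup∘tabulate c x) cx)
  blue : ∀ {x} → not (c x) ≡ true → x ∉ R
  blue {x} ¬cx x∈R with () ← trans (sym ¬cx)
    (cong not (trans (sym (lookup∘tabulate c x)) ([]=⇒lookup x∈R)))
  N⊈B : ∀ i → N k i ⊈ ∁ R
  N⊈B i N⊆B with x , x∈N , cx ← hitsN i = x∈p⇒x∉∁p (red cx) (N⊆B x∈N)
  A⊈R : ∀ i → A a j i ⊈ R
  A⊈R i A⊆R with x , x∈A , ¬cx ← hitsA i = blue ¬cx (A⊆R x∈A)
  partition : IsPartition (∁ R) R
  partition = record
    -- The arcs at 0 supply a blue element through `A` and a red one through `N`.
    { nonemptyˡ = _ , x∉p⇒x∈∁p (blue (proj₂ (proj₂ (hitsA (0 mod n)))))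
    ; nonemptyʳ = _ , red (proj₂ (proj₂ (hitsN (0 mod n))))
    ; disjoint  = ∩-inverseˡ R
    ; covering  = trans (∪-comm (∁ R) R) (p∪∁p≡⊤ R)
    }
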